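{- Let $L$ be an algebra in $\mathcal V_2$ satisfying the density axiom D2 and the splitting axiom S2. Let $L_0$ be a finite subalgebra of $L$ and $L_1$ a finite algebra in $\mathcal V_2$ containing $L_0$ as a subalgebra. Then there exists an embedding of $L_1$ into $L$ which fixes every point of $L_0$.
   Context: A co-Heyting algebra is a bounded distributive lattice $(L,\mathbf{0},\mathbf{1},\vee,\wedge)$ with a binary operation $-$ such that $a-b$ is the least $c\in L$ with $a\le b\vee c$; embeddings and subalgebras are in the language $\{\mathbf 0,\mathbf 1,\vee,\wedge,-\}$. For $a,b\in L$ write $b\ll a$ iff $a-b=a$ and $b\le a$. $\mathcal V_2$ is the variety of co-Heyting algebras satisfying $(\mathbf 1-x)\wedge(\mathbf 1-(\mathbf 1-x))=\mathbf 0$. Axiom D2: for all $a,c$ with $c\ll a$ and $a\neq\mathbf 0$ there is $b\neq\mathbf 0$ with $c\ll b\ll a$. Axiom S2: for all $a,b_1,b_2$ with $b_1\vee b_2\ll a\ne\mathbf 0$ and $b_1\wedge b_2\wedge(\mathbf 1-(\mathbf 1-a))=\mathbf 0$ there are non-zero $a_1,a_2$ with $a-a_2=a_1\ge b_1$, $a-a_1=a_2\ge b_2$, and $a_1\wedge a_2=b_1\wedge b_2$. -}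

module Defs where

open import Level using (Level; suc; _⊔_)
open import Data.Nat using (ℕ)
open import Data.Fin using (Fin)
open import Data.Product using (Σ; ∃; _×_; _,_)
open import Relation.Binary.PropositionalEquality using (_≡_)
open import Relation.Nullary using (¬_)
open import Function.Bundles using (_↔_)

record CoHeyting (ℓ : Level) : Set (suc ℓ) where
  infixr 6 _∨_
  infixr 7 _∧_
  infixl 8 _-_
  infix 4 _≤_
  field
    Carrier : Set ℓ
    𝟎 𝟏 : Carrier
    _∨_ _∧_ _-_ : Carrier → Carrier → Carrier
    ∨-assoc : ∀ x y z → (x ∨ y) ∨ z ≡ x ∨ (y ∨ z)
    ∨-comm : ∀ x y → x ∨ y ≡ y ∨ x
    ∧-assoc : ∀ x y z → (x ∧ y) ∧ z ≡ x ∧ (y ∧ z)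
    ∧-comm : ∀ x y → x ∧ y ≡ y ∧ x
    ∨-absorbs-∧ : ∀ x y → x ∨ (x ∧ y) ≡ x
    ∧-absorbs-∨ : ∀ x y → x ∧ (x ∨ y) ≡ x
    ∧-distribˡ-∨ : ∀ x y z → x ∧ (y ∨ z) ≡ (x ∧ y) ∨ (x ∧ z)
    ∨-identityʳ : ∀ x → x ∨ 𝟎 ≡ x
    ∧-identityʳ : ∀ x → x ∧ 𝟏 ≡ x

  _≤_ : Carrier → Carrier → Set ℓ
  a ≤ b = a ∧ b ≡ a

  field
    diff-ub : ∀ a b → a ≤ b ∨ (a - b)
    diff-least : ∀ a b c → a ≤ b ∨ c → a - b ≤ c

  _≪_ : Carrier → Carrier → Set ℓ
  b ≪ a = (a - b ≡ a) × (b ≤ a)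

∣_∣ : ∀ {ℓ} → CoHeyting ℓ → Set ℓ
∣ L ∣ = CoHeyting.Carrier L

InV₂ : ∀ {ℓ} → CoHeyting ℓ → Set ℓ
InV₂ L = ∀ x → (𝟏 - x) ∧ (𝟏 - (𝟏 - x)) ≡ 𝟎
  where open CoHeyting L

D2 : ∀ {ℓ} → CoHeyting ℓ → Set ℓ
D2 L = ∀ a c → c ≪ a → ¬ (a ≡ 𝟎) → Σ Carrier λ b → ¬ (b ≡ 𝟎) × c ≪ b × b ≪ a
  where open CoHeyting L

S2 : ∀ {ℓ} → CoHeyting ℓ → Set ℓ
S2 L = ∀ a b₁ b₂ → (b₁ ∨ b₂) ≪ a → ¬ (a ≡ 𝟎) → b₁ ∧ b₂ ∧ (𝟏 - (𝟏 - a)) ≡ 𝟎 →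
       Σ Carrier λ a₁ → Σ Carrier λ a₂ →
         ¬ (a₁ ≡ 𝟎) × ¬ (a₂ ≡ 𝟎) ×
         (a - a₂ ≡ a₁) × (b₁ ≤ a₁) ×
         (a - a₁ ≡ a₂) × (b₂ ≤ a₂) ×
         (a₁ ∧ a₂ ≡ b₁ ∧ b₂)
  where open CoHeyting L

Finite : ∀ {ℓ} → CoHeyting ℓ → Set ℓ
Finite L = Σ ℕ λ n → ∣ L ∣ ↔ Fin n

record IsEmbedding {ℓ₁ ℓ₂} (A : CoHeyting ℓ₁) (B : CoHeyting ℓ₂)
                   (f : ∣ A ∣ → ∣ B ∣) : Set (ℓ₁ ⊔ ℓ₂) where
  private
    module A = CoHeyting A
    module B = CoHeyting B
  field
    injective : ∀ x y → f x ≡ f y → x ≡ y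
    pres-𝟎 : f A.𝟎 ≡ B.𝟎
    pres-𝟏 : f A.𝟏 ≡ B.𝟏
    pres-∨ : ∀ x y → f (x A.∨ y) ≡ f x B.∨ f y
    pres-∧ : ∀ x y → f (x A.∧ y) ≡ f x B.∧ f y
    pres-- : ∀ x y → f (x A.- y) ≡ f x B.- f y

Embedding : ∀ {ℓ₁ ℓ₂} → CoHeyting ℓ₁ → CoHeyting ℓ₂ → Set (ℓ₁ ⊔ ℓ₂)
Embedding A B = Σ (∣ A ∣ → ∣ B ∣) (IsEmbedding A B)

module Submission where

open import Defs
open import Level using (Level; _⊔_)
open import Data.Bool using (Bool; true; false; not)
open import Data.Empty using (⊥-elim)
open import Data.Fin using (Fin; zero; suc)
open import Data.Fin.Induction using (spo-noetherian)
open import Data.Fin.Properties using (any?; all?) renaming (_≟_ to _≟ᶠ_)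
open import Data.List using (List; allFin; cartesianProduct; filter; length; lookup; map)
open import Data.List.Membership.Propositional using (_∈_; lose)
open import Data.List.Membership.Propositional.Properties
  using (∈-allFin; ∈-cartesianProduct⁺; ∈-filter⁺; ∈-lookup; ∈-map⁺)
open import Data.List.Properties using (filter-notAll)
open import Data.List.Relation.Unary.All as All using ()
open import Data.List.Relation.Unary.All.Properties using (all-filter)
open import Data.List.Relation.Unary.Any using (index)
open import Data.List.Relation.Unary.Any.Properties using (lookup-index)
open import Data.Nat using (ℕ) renaming (_<_ to _<ⁿ_)
open import Data.Nat.Induction using (<-wellFounded)
open import Data.Product using (Σ; ∃; _×_; _,_; proj₁; proj₂)
open import Data.Sum using (_⊎_; inj₁; inj₂; [_,_]′) renaming (map to map⊎)
open import Function using (_∘_; flip)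
open import Function.Bundles using (Inverse)
open import Function.Properties.Inverse using (↔⇒↣)
open import Induction.WellFounded using (Acc; acc)
open import Relation.Binary.Structures using (IsStrictPartialOrder)
open import Relation.Binary.PropositionalEquality
  using (_≡_; refl; sym; trans; cong; cong₂; subst; isEquivalence)
open import Relation.Nullary using (¬_; Dec; yes; no; contradiction)
open import Relation.Nullary.Decidable
  using (map′; via-injection; _×-dec_; _⊎-dec_; _→-dec_; ¬?; decidable-stable)
open import Relation.Unary using (Decidable; Pred)

-- Work dually, with the join-irreducible elements ("points") of L₁. An embedding of L₁ into L is a
-- family x of nonzero elements of L with join 𝟏, indexed by the points, monotone, with x ξ ∧ x η the join of the
-- x ζ for ζ below both, and with x ξ - x η = x ξ unless ξ ≤ η. These conditions make sense for any
-- quasiorder on the points. The inclusion of L₀ induces such a quasiorder, coarser than the order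
-- of L₁ and realised in L by the least elements of L₀ above the points. The order of L₁ is
-- reached from it by merging two points at a time: take ξ₁ maximal among the points that L₀ does
-- not separate from some other point, and ξ₂ maximal among those not separated from ξ₁. Then ξ₁, ξ₂
-- are incomparable with the same strict successors, or ξ₁ is the only cover of ξ₂. The merge is
-- undone in L by S2 in the first case; in the second, D2 interpolates below x ξ₁ an element that S2
-- then splits, and one of its two parts realises ξ₂.

-- Order calculus of co-Heyting algebras.

module Order {ℓ} (L : CoHeyting ℓ) where
  open CoHeyting L public

  infixr 5 _⟫_
  infix 4 _⊲_

  ≤-refl : ∀ {a} → a ≤ a
  ≤-refl {a} = trans (cong (a ∧_) (sym (∨-absorbs-∧ a a))) (∧-absorbs-∨ a (a ∧ a))

  ≤-reflexive : ∀ {a b} → a ≡ b → a ≤ b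
  ≤-reflexive refl = ≤-refl

  _⟫_ : ∀ {a b c} → a ≤ b → b ≤ c → a ≤ c
  _⟫_ {a} {b} {c} p q =
    trans (cong (_∧ c) (sym p)) (trans (∧-assoc a b c) (trans (cong (a ∧_) q) p))

  ≤-antisym : ∀ {a b} → a ≤ b → b ≤ a → a ≡ b
  ≤-antisym {a} {b} p q = trans (sym p) (trans (∧-comm a b) q)

  a≤a∨b : ∀ {a b} → a ≤ a ∨ b
  a≤a∨b {a} {b} = ∧-absorbs-∨ a b

  b≤a∨b : ∀ {a b} → b ≤ a ∨ b
  b≤a∨b {a} {b} = subst (b ≤_) (∨-comm b a) a≤a∨b

  ∨-lub : ∀ {a b c} → a ≤ c → b ≤ c → a ∨ b ≤ c
  ∨-lub {a} {b} {c} p q = trans (∧-comm (a ∨ b) c) (trans (∧-distribˡ-∨ c a b)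
    (cong₂ _∨_ (trans (∧-comm c a) p) (trans (∧-comm c b) q)))

  ∨-mono : ∀ {a b c d} → a ≤ c → b ≤ d → a ∨ b ≤ c ∨ d
  ∨-mono p q = ∨-lub (p ⟫ a≤a∨b) (q ⟫ b≤a∨b)

  a∧b≤b : ∀ {a b} → a ∧ b ≤ b
  a∧b≤b {a} {b} = trans (∧-assoc a b b) (cong (a ∧_) ≤-refl)

  a∧b≤a : ∀ {a b} → a ∧ b ≤ a
  a∧b≤a {a} {b} = subst (_≤ a) (∧-comm b a) a∧b≤b

  ∧-glb : ∀ {a b c} → c ≤ a → c ≤ b → c ≤ a ∧ b
  ∧-glb {a} {b} {c} p q = trans (sym (∧-assoc c a b)) (trans (cong (_∧ b) p) q)

  ∧-mono : ∀ {a b c d} → a ≤ c → b ≤ d → a ∧ b ≤ c ∧ d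
  ∧-mono p q = ∧-glb (a∧b≤a ⟫ p) (a∧b≤b ⟫ q)

  ∧-swap : ∀ {a b} → a ∧ b ≤ b ∧ a
  ∧-swap = ∧-glb a∧b≤b a∧b≤a

  ∧∨-lub : ∀ {a b c d} → a ∧ b ≤ d → a ∧ c ≤ d → a ∧ (b ∨ c) ≤ d
  ∧∨-lub {a} {b} {c} p q = ≤-reflexive (∧-distribˡ-∨ a b c) ⟫ ∨-lub p q

  𝟎≤ : ∀ {a} → 𝟎 ≤ a
  𝟎≤ {a} = subst (𝟎 ≤_) (∨-identityʳ a) b≤a∨b

  ≤𝟏 : ∀ {a} → a ≤ 𝟏
  ≤𝟏 = ∧-identityʳ _

  ≤𝟎⇒≡𝟎 : ∀ {a} → a ≤ 𝟎 → a ≡ 𝟎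
  ≤𝟎⇒≡𝟎 p = ≤-antisym p 𝟎≤

  diff≤ : ∀ {a b} → a - b ≤ a
  diff≤ = diff-least _ _ _ b≤a∨b

  -- a ⊲ b says a - b ≡ a; unlike b ≪ a it does not require b ≤ a.
  _⊲_ : Carrier → Carrier → Set ℓ
  a ⊲ b = ∀ {d} → a ≤ b ∨ d → a ≤ d

  ⊲⇒≡ : ∀ {a b} → a ⊲ b → a - b ≡ a
  ⊲⇒≡ s = ≤-antisym diff≤ (s (diff-ub _ _))

  ≡⇒⊲ : ∀ {a b} → a - b ≡ a → a ⊲ b
  ≡⇒⊲ e p = ≤-reflexive (sym e) ⟫ diff-least _ _ _ p

  ⊲-𝟎 : ∀ {a} → a ⊲ 𝟎
  ⊲-𝟎 p = p ⟫ ∨-lub 𝟎≤ ≤-refl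

  ⊲-∨ : ∀ {a b c} → a ⊲ b → a ⊲ c → a ⊲ (b ∨ c)
  ⊲-∨ s t p = t (s (p ⟫ ≤-reflexive (∨-assoc _ _ _)))

  ⊲-antitone : ∀ {a b c} → c ≤ b → a ⊲ b → a ⊲ c
  ⊲-antitone q s p = s (p ⟫ ∨-mono q ≤-refl)

  -- Only the trace of `c` on `a` matters: `a ≤ c ∨ d` gives `a ≤ (a ∧ c) ∨ d` by distributivity.
  ⊲-∧ : ∀ {a b c} → a ∧ c ≤ b → a ⊲ b → a ⊲ c
  ⊲-∧ q s p = s (∧-glb ≤-refl p ⟫ ∧∨-lub (q ⟫ a≤a∨b) (a∧b≤b ⟫ b≤a∨b))

  ⊲-diff : ∀ {a b c} → a ⊲ c → (a - b) ⊲ c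
  ⊲-diff {a} {b} s {d} p = diff-least _ _ _
    (s (diff-ub a b ⟫ ∨-mono ≤-refl p ⟫ ∨-lub (a≤a∨b ⟫ b≤a∨b) (∨-mono ≤-refl b≤a∨b)))

  ⊲-above⇒≡𝟎 : ∀ {a b} → a ⊲ b → a ≤ b → a ≡ 𝟎
  ⊲-above⇒≡𝟎 s p = ≤𝟎⇒≡𝟎 (s (p ⟫ a≤a∨b))

  -- From `b ≤ a ∨ (𝟏 - a)` follows `a ≤ b ≤ 𝟏 - a`, so `𝟏 - a` is already `𝟏`.
  ⊲⇒regular-part≡𝟎 : ∀ {a b} → a ≤ b → b ⊲ a → 𝟏 - (𝟏 - a) ≡ 𝟎
  ⊲⇒regular-part≡𝟎 {a} p s =
    ≤𝟎⇒≡𝟎 (diff-least _ _ _ (diff-ub 𝟏 a ⟫ ∨-lub (p ⟫ s (≤𝟏 ⟫ diff-ub 𝟏 a)) ≤-refl ⟫ a≤a∨b))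

-- Finite joins over decidable sets of indices.

module Joins {ℓ} (L : CoHeyting ℓ) where
  open Order L

  when : ∀ {p} {P : Set p} → Dec P → Carrier → Carrier
  when (yes _) a = a
  when (no _)  _ = 𝟎

  ⋁ : ∀ {n p} {U : Pred (Fin n) p} → Decidable U → (Fin n → Carrier) → Carrier
  ⋁ {ℕ.zero}  U? x = 𝟎
  ⋁ {ℕ.suc n} U? x = when (U? zero) (x zero) ∨ ⋁ (λ ξ → U? (suc ξ)) (x ∘ suc)

  ⋁-ind : ∀ {n p q} {U : Pred (Fin n) p} (U? : Decidable U) {x : Fin n → Carrier} →
          (P : Pred Carrier q) → P 𝟎 → (∀ {a b} → P a → P b → P (a ∨ b)) →
          (∀ ξ → U ξ → P (x ξ)) → P (⋁ U? x)
  ⋁-ind {ℕ.zero}  U? P p₀ p∨ f = p₀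
  ⋁-ind {ℕ.suc n} U? P p₀ p∨ f = p∨ head (⋁-ind (λ ξ → U? (suc ξ)) P p₀ p∨ (λ ξ → f (suc ξ)))
    where
    head : P (when (U? zero) _)
    head with U? zero
    ... | yes u = f zero u
    ... | no  _ = p₀

  module _ {n p} {U : Pred (Fin n) p} (U? : Decidable U) {x : Fin n → Carrier} where

    ⋁-least : ∀ {c} → (∀ ξ → U ξ → x ξ ≤ c) → ⋁ U? x ≤ c
    ⋁-least = ⋁-ind U? (_≤ _) 𝟎≤ ∨-lub

    ⋁-⊲ : ∀ {a} → (∀ ξ → U ξ → a ⊲ x ξ) → a ⊲ ⋁ U? x
    ⋁-⊲ {a} f = ⋁-ind U? (a ⊲_) ⊲-𝟎 (λ s t → ⊲-∨ s t) (λ ξ u → f ξ u)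

    ∧-⋁-least : ∀ {a d} → (∀ ξ → U ξ → a ∧ x ξ ≤ d) → a ∧ ⋁ U? x ≤ d
    ∧-⋁-least {a} {d} = ⋁-ind U? (λ b → a ∧ b ≤ d) (a∧b≤b ⟫ 𝟎≤) ∧∨-lub

  ⋁-upper : ∀ {n p} {U : Pred (Fin n) p} (U? : Decidable U) {x : Fin n → Carrier} →
            ∀ ξ → U ξ → x ξ ≤ ⋁ U? x
  ⋁-upper U? zero u with U? zero
  ... | yes _ = a≤a∨b
  ... | no ¬u = contradiction u ¬u
  ⋁-upper U? (suc ξ) u = ⋁-upper (λ ξ → U? (suc ξ)) ξ u ⟫ b≤a∨b

  ⋁-mono : ∀ {n p q} {U : Pred (Fin n) p} (U? : Decidable U) {V : Pred (Fin n) q} (V? : Decidable V)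
           {x : Fin n → Carrier} → (∀ ξ → U ξ → V ξ) → ⋁ U? x ≤ ⋁ V? x
  ⋁-mono U? V? f = ⋁-least U? (λ ξ u → ⋁-upper V? ξ (f ξ u))

  ⋁-∧-⋁-least : ∀ {n m p q} {U : Pred (Fin n) p} (U? : Decidable U)
                {V : Pred (Fin m) q} (V? : Decidable V)
                {x : Fin n → Carrier} {y : Fin m → Carrier} {d : Carrier} →
                (∀ ξ η → U ξ → V η → x ξ ∧ y η ≤ d) → ⋁ U? x ∧ ⋁ V? y ≤ d
  ⋁-∧-⋁-least U? V? f = ∧-⋁-least V? (λ η v → ∧-swap ⟫
    ∧-⋁-least U? (λ ξ u → ∧-swap ⟫ f ξ η u v))

-- Consequences of the splitting axiom.

module Splits {ℓ} (L : CoHeyting ℓ) where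
  open Order L

  record Split (a : Carrier) (b : Bool → Carrier) : Set ℓ where
    field
      part         : Bool → Carrier
      part≢𝟎       : ∀ i → ¬ (part i ≡ 𝟎)
      part≤whole   : ∀ i → part i ≤ a
      whole≤parts  : a ≤ part true ∨ part false
      lower≤part   : ∀ i → b i ≤ part i
      parts-∧      : part true ∧ part false ≤ b true ∧ b false
      part-⊲-part  : ∀ i → part i ⊲ part (not i)
      part-⊲-lower : ∀ i → part i ⊲ (b true ∨ b false)

    -- The other lower bound lies in the other part, and the two parts meet only in
    -- `b true ∧ b false`.
    part-∧-lower : ∀ i → part i ∧ (b true ∨ b false) ≤ b i
    part-∧-lower true = ∧∨-lub a∧b≤b (∧-mono ≤-refl (lower≤part false) ⟫ parts-∧ ⟫ a∧b≤a)
    part-∧-lower false = ∧∨-lub (∧-mono ≤-refl (lower≤part true) ⟫ ∧-swap ⟫ parts-∧ ⟫ a∧b≤b) a∧b≤b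

  split : S2 L → ∀ {a b} → (b true ∨ b false) ≪ a → ¬ (a ≡ 𝟎) →
          b true ∧ b false ∧ (𝟏 - (𝟏 - a)) ≡ 𝟎 → Split a b
  split s2 {a} {b} b≪a a≢𝟎 e
    with a₁ , a₂ , a₁≢𝟎 , a₂≢𝟎 , refl , b₁≤a₁ , e₂ , b₂≤a₂ , e∧ ← s2 a (b true) (b false) b≪a a≢𝟎 e
    = record
      { part         = part
      ; part≢𝟎       = λ { true → a₁≢𝟎 ; false → a₂≢𝟎 }
      ; part≤whole   = λ { true → diff≤ ; false → a₂≤a }
      ; whole≤parts  = diff-ub a a₂ ⟫ ∨-lub b≤a∨b a≤a∨b
      ; lower≤part   = λ { true → b₁≤a₁ ; false → b₂≤a₂ }
      ; parts-∧      = ≤-reflexive e∧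
      -- Subtracting `a₂` from `a` a second time changes nothing; the other case is the same with
      -- `a₂` read as `a - (a - a₂)`.
      ; part-⊲-part  = λ where
          true  p → diff-least a a₂ _ (diff-ub a a₂ ⟫ ∨-lub a≤a∨b p)
          false p → ≤-reflexive (sym e₂) ⟫
            diff-least a (a - a₂) _ (diff-ub a (a - a₂) ⟫ ∨-lub a≤a∨b (≤-reflexive e₂ ⟫ p))
      ; part-⊲-lower = λ where
          true  → ⊲-diff a⊲b
          false → subst (_⊲ _) e₂ (⊲-diff a⊲b)
      }
    where
    part : Bool → Carrier
    part true = a - a₂
    part false = a₂

    a₂≤a : a₂ ≤ a
    a₂≤a = ≤-reflexive (sym e₂) ⟫ diff≤

    a⊲b : a ⊲ (b true ∨ b false)
    a⊲b = ≡⇒⊲ (proj₁ b≪a)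

-- Finite quasiorders and their realisations.

record Quasiorder (n : ℕ) (r : Level) : Set (Level.suc r) where
  infix 4 _⊑_ _⊑?_ _≈_ _≈?_
  field
    _⊑_     : Fin n → Fin n → Set r
    _⊑?_    : ∀ ξ η → Dec (ξ ⊑ η)
    ⊑-refl  : ∀ {ξ} → ξ ⊑ ξ
    ⊑-trans : ∀ {ξ η ζ} → ξ ⊑ η → η ⊑ ζ → ξ ⊑ ζ

  _≈_ : Fin n → Fin n → Set r
  ξ ≈ η = (ξ ⊑ η) × (η ⊑ ξ)

  _≈?_ : ∀ ξ η → Dec (ξ ≈ η)
  ξ ≈? η = (ξ ⊑? η) ×-dec (η ⊑? ξ)

  ≈-sym : ∀ {ξ η} → ξ ≈ η → η ≈ ξ
  ≈-sym (p , q) = q , p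

  ≈-trans : ∀ {ξ η ζ} → ξ ≈ η → η ≈ ζ → ξ ≈ ζ
  ≈-trans (p , q) (r , s) = ⊑-trans p r , ⊑-trans s q

  Below₂ : Fin n → Fin n → Pred (Fin n) r
  Below₂ ξ η ζ = (ζ ⊑ ξ) × (ζ ⊑ η)

  below₂? : ∀ ξ η → Decidable (Below₂ ξ η)
  below₂? ξ η ζ = (ζ ⊑? ξ) ×-dec (ζ ⊑? η)

  -- The dual form of the V₂ identity: in a finite quasiorder it gives each connected component a
  -- single maximal class.
  Directed : Set r
  Directed = ∀ {ζ ξ η} → ζ ⊑ ξ → ζ ⊑ η → ∃ λ ω → (ξ ⊑ ω) × (η ⊑ ω)

  Maximal : ∀ {p} → Pred (Fin n) p → Pred (Fin n) (p ⊔ r)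
  Maximal P η = P η × (∀ ζ → P ζ → η ⊑ ζ → ζ ⊑ η)

  maximal-above : ∀ {p} {P : Pred (Fin n) p} → Decidable P →
                  ∀ ξ → P ξ → ∃ λ η → (ξ ⊑ η) × Maximal P η
  maximal-above {P = P} P? ξ Pξ = go ξ Pξ (spo-noetherian strict ξ)
    where
    _⊏_ : Fin n → Fin n → Set r
    ξ ⊏ η = (ξ ⊑ η) × ¬ (η ⊑ ξ)

    strict : IsStrictPartialOrder _≡_ _⊏_
    strict = record
      { isEquivalence = isEquivalence
      ; irrefl = λ { refl (p , ¬p) → ¬p p }
      ; trans  = λ (p , ¬p) (q , _) → ⊑-trans p q , λ s → ¬p (⊑-trans q s)
      ; <-resp-≈ = (λ { refl s → s }) , (λ { refl s → s })
      }

    go : ∀ ξ → P ξ → Acc (flip _⊏_) ξ → ∃ λ η → (ξ ⊑ η) × Maximal P η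
    go ξ Pξ (acc rec) with any? (λ ζ → P? ζ ×-dec ((ξ ⊑? ζ) ×-dec ¬? (ζ ⊑? ξ)))
    ... | yes (ζ , Pζ , s) = let η , t , m = go ζ Pζ (rec s) in η , ⊑-trans (proj₁ s) t , m
    ... | no none = ξ , ⊑-refl , Pξ , λ ζ Pζ p →
      decidable-stable (ζ ⊑? ξ) (λ ¬q → none (ζ , Pζ , p , ¬q))

-- The dual of an embedding of the algebra of ⊑-down-sets into L: a down-set U is sent to ⋁ U x.
record Realisation {ℓ n r} (L : CoHeyting ℓ) (Q : Quasiorder n r) (x : Fin n → ∣ L ∣) : Set (ℓ ⊔ r) where
  open Order L
  open Joins L
  open Quasiorder Q
  field
    nonzero     : ∀ ξ → ¬ (x ξ ≡ 𝟎)
    mono        : ∀ {ξ η} → ξ ⊑ η → x ξ ≤ x η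
    meet        : ∀ ξ η → x ξ ∧ x η ≤ ⋁ (below₂? ξ η) x
    independent : ∀ {ξ η} → ¬ (ξ ⊑ η) → x ξ ⊲ x η

∃Bool? : ∀ {p} {P : Pred Bool p} → Decidable P → Dec (∃ P)
∃Bool? P? = map′ [ true ,_ , false ,_ ]′ (λ { (true , p) → inj₁ p ; (false , p) → inj₂ p })
                 (P? true ⊎-dec P? false)

-- The two points are incomparable with the same strict successors, or pt false < pt true and
-- pt true is the only cover of pt false.
record Mergeable {n r} (Q : Quasiorder n r) (pt : Bool → Fin n) : Set r where
  open Quasiorder Q
  field
    true⋢false : ¬ (pt true ⊑ pt false)
    successor  : ∀ i {ζ} → pt i ⊑ ζ → (ζ ⊑ pt i) ⊎ (pt (not i) ⊑ ζ)

-- The quotient that identifies two points.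

module Merge {n r} (Q : Quasiorder n r) {pt : Bool → Fin n} (mergeable : Mergeable Q pt) where
  open Quasiorder Q
  open Mergeable mergeable

  Under Over Old : Pred (Fin n) r
  Under ζ = ∃ λ i → ζ ⊑ pt i
  Over ζ = ∃ λ i → pt i ⊑ ζ
  Old ξ = ∀ i → ¬ (ξ ≈ pt i)

  data Kind (ξ : Fin n) : Set r where
    old : Old ξ → Kind ξ
    at  : ∀ i → ξ ≈ pt i → Kind ξ

  kind : ∀ ξ → Kind ξ
  kind ξ with ∃Bool? (λ i → ξ ≈? pt i)
  ... | yes (i , e) = at i e
  ... | no none     = old (λ i e → none (i , e))

  old? : Decidable Old
  old? ξ with kind ξ
  ... | old o  = yes o
  ... | at i e = no (λ o → o i e)

  at-unique : ∀ {ξ i j} → ξ ≈ pt i → ξ ≈ pt j → i ≡ j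
  at-unique {i = true}  {true}  p q = refl
  at-unique {i = true}  {false} p q = contradiction (⊑-trans (proj₂ p) (proj₁ q)) true⋢false
  at-unique {i = false} {true}  p q = contradiction (⊑-trans (proj₂ q) (proj₁ p)) true⋢false
  at-unique {i = false} {false} p q = refl

  -- The first alternative of `successor` would make `ξ` equivalent to a merged point. Hence merging
  -- adds no relation with an old upper end.
  over-both : ∀ {ξ} → Old ξ → Over ξ → ∀ j → pt j ⊑ ξ
  over-both o (i , p) j with successor i p
  over-both o (i     , p) j     | inj₁ q = contradiction (q , p) (o i)
  over-both o (true  , p) true  | inj₂ q = p
  over-both o (true  , p) false | inj₂ q = q
  over-both o (false , p) true  | inj₂ q = q
  over-both o (false , p) false | inj₂ q = p

  -- The transitive closure of `⊑` with the two points identified; one passage through the pair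
  -- suffices, since two of them shorten to one.
  merged : Quasiorder n r
  merged = record
    { _⊑_     = λ ξ η → (ξ ⊑ η) ⊎ (Under ξ × Over η)
    ; _⊑?_    = λ ξ η → (ξ ⊑? η) ⊎-dec (∃Bool? (λ i → ξ ⊑? pt i) ×-dec ∃Bool? (λ i → pt i ⊑? η))
    ; ⊑-refl  = inj₁ ⊑-refl
    ; ⊑-trans = λ where
        (inj₁ p)       (inj₁ q)             → inj₁ (⊑-trans p q)
        (inj₁ p)       (inj₂ ((i , q) , o)) → inj₂ ((i , ⊑-trans p q) , o)
        (inj₂ (u , i , p)) (inj₁ q)         → inj₂ (u , i , ⊑-trans p q)
        (inj₂ (u , _)) (inj₂ (_ , o))       → inj₂ (u , o)
    }

  module M = Quasiorder merged

  under⇒⊑ : ∀ {ξ} → Under ξ → ∀ j → ξ M.⊑ pt j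
  under⇒⊑ u j = inj₂ (u , j , ⊑-refl)

  over⇒⊑ : ∀ {ξ} → Over ξ → ∀ j → pt j M.⊑ ξ
  over⇒⊑ o j = inj₂ ((j , ⊑-refl) , o)

  ⊑⇒under : ∀ {ξ j} → ξ M.⊑ pt j → Under ξ
  ⊑⇒under {j = j} (inj₁ p) = j , p
  ⊑⇒under (inj₂ (u , _)) = u

  ⊑⇒over : ∀ {ξ j} → pt j M.⊑ ξ → Over ξ
  ⊑⇒over {j = j} (inj₁ p) = j , p
  ⊑⇒over (inj₂ (_ , o)) = o

  ⊑-old : ∀ {ξ η} → Old η → ξ M.⊑ η → ξ ⊑ η
  ⊑-old o (inj₁ p) = p
  ⊑-old o (inj₂ ((i , p) , q)) = ⊑-trans p (over-both o q i)

  at⇒pt : ∀ {ξ i} → ξ ≈ pt i → ∀ j → ξ M.≈ pt j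
  at⇒pt {i = i} (p , q) j = under⇒⊑ (i , p) j , over⇒⊑ (i , q) j

  -- The quotient map onto the merged order is a p-morphism.
  ⊑-lift : ∀ {ξ η} → ξ M.⊑ η → ∃ λ η′ → (ξ ⊑ η′) × (η M.≈ η′)
  ⊑-lift {ξ} {η} p with kind η
  ... | old o = η , ⊑-old o p , M.⊑-refl , M.⊑-refl
  ... | at i e = let j , q = ⊑⇒under (M.⊑-trans p (proj₁ (at⇒pt e i))) in pt j , q , at⇒pt e j

  old-under : ∀ {ξ} → Old ξ → Under ξ → ∀ {j} → ¬ (pt j M.⊑ ξ)
  old-under o (i , p) q = o i (p , over-both o (⊑⇒over q) i)

-- Undoing a merge inside `L`.

module Unmerge {ℓ n r} (L : CoHeyting ℓ) (Q : Quasiorder n r) {pt : Bool → Fin n}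
             (mergeable : Mergeable Q pt)
             {x′ : Fin n → ∣ L ∣} (ρ : Realisation L (Merge.merged Q mergeable) x′) where
  open Order L
  open Joins L
  open Quasiorder Q
  open Mergeable mergeable
  open Merge Q mergeable
  open Realisation ρ

  OldUnder : Bool → Pred (Fin n) r
  OldUnder i ζ = Old ζ × (ζ ⊑ pt i)

  oldUnder? : ∀ i → Decidable (OldUnder i)
  oldUnder? i ζ = old? ζ ×-dec (ζ ⊑? pt i)

  top : Carrier
  top = x′ (pt true)

  strictly-below : Bool → Carrier
  strictly-below i = ⋁ (oldUnder? i) x′

  boundary : Carrier
  boundary = strictly-below true ∨ strictly-below false

  strictly-below≤boundary : ∀ i → strictly-below i ≤ boundary
  strictly-below≤boundary true = a≤a∨b
  strictly-below≤boundary false = b≤a∨b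

  old≤boundary : ∀ {ξ} → Old ξ → Under ξ → x′ ξ ≤ boundary
  old≤boundary {ξ} o (i , p) = ⋁-upper (oldUnder? i) ξ (o , p) ⟫ strictly-below≤boundary i

  boundary≤ : ∀ {d} → (∀ ξ → Old ξ → Under ξ → x′ ξ ≤ d) → boundary ≤ d
  boundary≤ f = ∨-lub (⋁-least (oldUnder? true) (λ ξ (o , p) → f ξ o (true , p)))
                      (⋁-least (oldUnder? false) (λ ξ (o , p) → f ξ o (false , p)))

  at≤top : ∀ {ξ i} → ξ ≈ pt i → x′ ξ ≤ top
  at≤top e = mono (proj₁ (at⇒pt e true))

  top≤at : ∀ {ξ i} → ξ ≈ pt i → top ≤ x′ ξ
  top≤at e = mono (proj₂ (at⇒pt e true))

  boundary≤top : boundary ≤ top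
  boundary≤top = boundary≤ (λ ξ o u → mono (under⇒⊑ u true))

  top⊲boundary : top ⊲ boundary
  top⊲boundary = ⊲-∨ (below true) (below false)
    where
    below : ∀ i → top ⊲ strictly-below i
    below i = ⋁-⊲ (oldUnder? i) (λ ξ (o , p) → independent (old-under o (i , p)))

  -- What `Refine` asks of the elements that replace `top`, in a form common to comparable and
  -- incomparable pairs. `part-∧` has two alternatives because for comparable points `part false`
  -- itself bounds the meet.
  record Splitting : Set (ℓ ⊔ r) where
    field
      part          : Bool → Carrier
      part≢𝟎        : ∀ i → ¬ (part i ≡ 𝟎)
      part≤top      : ∀ i → part i ≤ top
      top≤parts     : top ≤ part true ∨ part false
      below≤part    : ∀ i → strictly-below i ≤ part i
      part∧boundary : ∀ i → part i ∧ boundary ≤ strictly-below i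
      part⊲boundary : ∀ i → part i ⊲ boundary
      part-mono     : ∀ i j → pt i ⊑ pt j → part i ≤ part j
      part-⊲        : ∀ i j → ¬ (pt i ⊑ pt j) → part i ⊲ part j
      part-∧        : (pt false ⊑ pt true) ⊎
                      (part true ∧ part false ≤ strictly-below true ∧ strictly-below false)

  module Refine (splitting : Splitting) where
    open Splitting splitting

    -- Takes any classification of `ξ` instead of computing `kind ξ`, so that later lemmas can match
    -- on it; `value-unique` makes the choice immaterial.
    value : ∀ {ξ} → Kind ξ → Carrier
    value {ξ} (old _)  = x′ ξ
    value     (at i _) = part i

    x : Fin n → Carrier
    x ξ = value (kind ξ)

    value-unique : ∀ {ξ} (k l : Kind ξ) → value k ≡ value l
    value-unique (old _)  (old _)  = refl
    value-unique (old o)  (at j e) = contradiction e (o j)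
    value-unique (at i e) (old o)  = contradiction e (o i)
    value-unique (at i e) (at j f) = cong part (at-unique e f)

    value≤⋁ : ∀ {p} {U : Pred (Fin n) p} (U? : Decidable U) {ξ} (k : Kind ξ) → U ξ → value k ≤ ⋁ U? x
    value≤⋁ U? {ξ} k u = ≤-reflexive (value-unique k (kind ξ)) ⟫ ⋁-upper U? ξ u

    part≤⋁ : ∀ {p} {U : Pred (Fin n) p} (U? : Decidable U) i → U (pt i) → part i ≤ ⋁ U? x
    part≤⋁ U? i u = value≤⋁ U? (at i (⊑-refl , ⊑-refl)) u

    ⋁-refine-≥ : ∀ {p} {U : Pred (Fin n) p} (U? : Decidable U) →
                 (∀ {ξ η} → ξ M.⊑ η → U η → U ξ) → ⋁ U? x′ ≤ ⋁ U? x
    ⋁-refine-≥ {U = U} U? down = ⋁-least U? (λ ξ u → bound u (kind ξ))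
      where
      bound : ∀ {ξ} → U ξ → Kind ξ → x′ ξ ≤ ⋁ U? x
      bound u k@(old _) = value≤⋁ U? k u
      bound u (at i e)  = at≤top e ⟫ top≤parts ⟫
        ∨-lub (part≤⋁ U? true (down (proj₂ (at⇒pt e true)) u))
              (part≤⋁ U? false (down (proj₂ (at⇒pt e false)) u))

    -- A down-set of the merged order contains both points or neither, and the two parts join to
    -- `top`. This is what keeps `L₀` fixed when a merge is undone.
    ⋁-refine : ∀ {p} {U : Pred (Fin n) p} (U? : Decidable U) →
               (∀ {ξ η} → ξ M.⊑ η → U η → U ξ) → ⋁ U? x ≡ ⋁ U? x′
    ⋁-refine U? down = ≤-antisym (⋁-least U? (λ ξ u → bound (kind ξ) ⟫ ⋁-upper U? ξ u))
                                 (⋁-refine-≥ U? down)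
      where
      bound : ∀ {ξ} (k : Kind ξ) → value k ≤ x′ ξ
      bound (old _)  = ≤-refl
      bound (at i e) = part≤top i ⟫ top≤at e

    value≢𝟎 : ∀ {ξ} (k : Kind ξ) → ¬ (value k ≡ 𝟎)
    value≢𝟎 (old _)  = nonzero _
    value≢𝟎 (at i _) = part≢𝟎 i

    value-mono : ∀ {ξ η} (k : Kind ξ) (l : Kind η) → ξ ⊑ η → value k ≤ value l
    value-mono (old _) (old _) p = mono (inj₁ p)
    value-mono {ξ} (old o) (at j (q , _)) p =
      ⋁-upper (oldUnder? j) ξ (o , ⊑-trans p q) ⟫ below≤part j
    value-mono (at i (_ , q)) (old o) p = part≤top i ⟫ mono (over⇒⊑ (i , ⊑-trans q p) true)
    value-mono (at i (_ , q)) (at j (r , _)) p = part-mono i j (⊑-trans q (⊑-trans p r))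

    value-⊲ : ∀ {ξ η} (k : Kind ξ) (l : Kind η) → ¬ (ξ ⊑ η) → value k ⊲ value l
    value-⊲ (old _) (old o) ¬p = independent (λ q → ¬p (⊑-old o q))
    value-⊲ {ξ} (old o) (at j (_ , q)) ¬p with ∃Bool? (λ i → ξ ⊑? pt i)
    ... | no ¬u = ⊲-antitone (part≤top j) (independent (λ p → ¬u (⊑⇒under p)))
    -- `x′ ξ` lies in the boundary, which `part j` meets inside `strictly-below j`; only
    -- independence from the old points below `pt j` remains.
    ... | yes u = ⊲-∧ (∧-glb a∧b≤b (a∧b≤a ⟫ old≤boundary o u) ⟫ part∧boundary j)
      (⋁-⊲ (oldUnder? j) (λ ζ (o′ , p) → independent (λ s → ¬p (⊑-trans (⊑-old o′ s) (⊑-trans p q)))))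
    -- The meet of `top` and `x′ η` is covered by common lower points. None of them is in the merged
    -- class, as `η` would then be above `ξ`; so the meet lies in the boundary.
    value-⊲ {_} {η} (at i (q , _)) (old o) ¬p = ⊲-∧ (∧-mono (part≤top i) ≤-refl ⟫ meet (pt true) η ⟫
      ⋁-least (M.below₂? (pt true) η) (λ ζ (s , t) → bound s t (kind ζ))) (part⊲boundary i)
      where
      bound : ∀ {ζ} → ζ M.⊑ pt true → ζ M.⊑ η → Kind ζ → x′ ζ ≤ boundary
      bound s t (old o′) = old≤boundary o′ (⊑⇒under s)
      bound s t (at j e) =
        contradiction (⊑-trans q (⊑-old o (M.⊑-trans (proj₂ (at⇒pt e i)) t))) ¬p
    value-⊲ (at i (p , _)) (at j (_ , q)) ¬r = part-⊲ i j (λ s → ¬r (⊑-trans p (⊑-trans s q)))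

    meet-old : ∀ {ξ η} → Old ξ → Old η → x′ ξ ∧ x′ η ≤ ⋁ (below₂? ξ η) x
    meet-old {ξ} {η} o o′ = meet ξ η ⟫
      ⋁-refine-≥ (M.below₂? ξ η) (λ p (q , r) → M.⊑-trans p q , M.⊑-trans p r) ⟫
      ⋁-mono (M.below₂? ξ η) (below₂? ξ η) (λ ζ (q , r) → ⊑-old o q , ⊑-old o′ r)

    meet-swap : ∀ {ξ η} {a b : Carrier} → a ∧ b ≤ ⋁ (below₂? ξ η) x → b ∧ a ≤ ⋁ (below₂? η ξ) x
    meet-swap {ξ} {η} p = ∧-swap ⟫ p ⟫ ⋁-mono (below₂? ξ η) (below₂? η ξ) (λ ζ (q , r) → r , q)

    meet-old-at : ∀ {ξ η i} → Old ξ → η ≈ pt i → x′ ξ ∧ part i ≤ ⋁ (below₂? ξ η) x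
    meet-old-at {ξ} {η} {i} o e@(_ , q) with pt true M.⊑? ξ
    ... | yes p = a∧b≤b ⟫ part≤⋁ (below₂? ξ η) i (over-both o (⊑⇒over p) i , q)
    -- The merged class is not below `ξ`, so the meet lies in the boundary, hence in
    -- `strictly-below i`, a join of old points.
    ... | no ¬p = ∧-glb a∧b≤a (∧-glb a∧b≤b (∧-mono ≤-refl (part≤top i) ⟫ meet ξ (pt true) ⟫
        ⋁-least (M.below₂? ξ (pt true)) (λ ζ (s , t) → bound s t (kind ζ))) ⟫ part∧boundary i) ⟫
        ∧-⋁-least (oldUnder? i) (λ ζ (o′ , s) → meet-old o o′ ⟫
          ⋁-mono (below₂? ξ ζ) (below₂? ξ η) (λ ω (t , u) → t , ⊑-trans u (⊑-trans s q)))
      where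
      bound : ∀ {ζ} → ζ M.⊑ ξ → ζ M.⊑ pt true → Kind ζ → x′ ζ ≤ boundary
      bound s t (old o′) = old≤boundary o′ (⊑⇒under t)
      bound s t (at j e) = contradiction (M.⊑-trans (proj₂ (at⇒pt e true)) s) ¬p

    meet-parts : ∀ {ξ η} → ξ ≈ pt true → η ≈ pt false →
                 part true ∧ part false ≤ ⋁ (below₂? ξ η) x
    meet-parts {ξ} {η} (_ , p) (_ , q) with part-∧
    ... | inj₁ s = a∧b≤b ⟫ part≤⋁ (below₂? ξ η) false (⊑-trans s p , q)
    ... | inj₂ s = s ⟫ ⋁-∧-⋁-least (oldUnder? true) (oldUnder? false)
      (λ ζ ω (o , t) (o′ , u) → meet-old o o′ ⟫ ⋁-mono (below₂? ζ ω) (below₂? ξ η)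
        (λ _ (v , w) → ⊑-trans v (⊑-trans t p) , ⊑-trans w (⊑-trans u q)))

    value-∧ : ∀ {ξ η} (k : Kind ξ) (l : Kind η) → value k ∧ value l ≤ ⋁ (below₂? ξ η) x
    value-∧ (old o) (old o′) = meet-old o o′
    value-∧ (old o) (at j e) = meet-old-at o e
    value-∧ (at i e) (old o) = meet-swap (meet-old-at o e)
    value-∧ {ξ} {η} (at true p) (at true q) =
      a∧b≤a ⟫ part≤⋁ (below₂? ξ η) true (proj₂ p , proj₂ q)
    value-∧ (at true p) (at false q) = meet-parts p q
    value-∧ (at false p) (at true q) = meet-swap (meet-parts q p)
    value-∧ {ξ} {η} (at false p) (at false q) =
      a∧b≤a ⟫ part≤⋁ (below₂? ξ η) false (proj₂ p , proj₂ q)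

    refined : Realisation L Q x
    refined = record
      { nonzero     = λ ξ → value≢𝟎 (kind ξ)
      ; mono        = λ {ξ} {η} → value-mono (kind ξ) (kind η)
      ; meet        = λ ξ η → value-∧ (kind ξ) (kind η)
      ; independent = λ {ξ} {η} ¬p → value-⊲ (kind ξ) (kind η) ¬p
      }

  boundary≪top : boundary ≪ top
  boundary≪top = ⊲⇒≡ top⊲boundary , boundary≤top

  open Splits L using (module Split; split)

  -- `pt true` keeps `top`. The interpolant `b` lies above the whole boundary, which may exceed what
  -- is below `pt false`; splitting `b` and keeping `part false` cuts the trace down to
  -- `strictly-below false`. S2 applies because `b ≪ top` makes the regular part of `b` vanish.
  splitting-of-comparable : D2 L → S2 L → pt false ⊑ pt true → Splitting
  splitting-of-comparable d2 s2 f⊑t with d2 top boundary boundary≪top (nonzero (pt true))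
  ... | b , b≢𝟎 , boundary≪b , b≪top = record
    { part          = part′
    ; part≢𝟎        = λ { true → nonzero (pt true) ; false → part≢𝟎 false }
    ; part≤top      = part′≤top
    ; top≤parts     = a≤a∨b
    ; below≤part    = λ { true → strictly-below≤boundary true ⟫ boundary≤top ; false → lower≤part false }
    ; part∧boundary = λ { true → a∧b≤b ⟫ boundary≤below-true ; false → part-∧-lower false }
    ; part⊲boundary = λ { true → top⊲boundary ; false → part-⊲-lower false }
    ; part-mono     = λ where
        true  true  _ → ≤-refl
        true  false p → contradiction p true⋢false
        false true  _ → part′≤top false
        false false _ → ≤-refl
    ; part-⊲        = λ where
        true  true  ¬p → contradiction ⊑-refl ¬p
        true  false _  → ⊲-antitone (part≤whole false) (≡⇒⊲ (proj₁ b≪top))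
        false true  ¬p → contradiction f⊑t ¬p
        false false ¬p → contradiction ⊑-refl ¬p
    ; part-∧        = inj₁ f⊑t
    }
    where
    regular-part≡𝟎 : 𝟏 - (𝟏 - b) ≡ 𝟎
    regular-part≡𝟎 = ⊲⇒regular-part≡𝟎 (proj₂ b≪top) (≡⇒⊲ (proj₁ b≪top))

    open Split (split s2 {b} {strictly-below} boundary≪b b≢𝟎
      (≤𝟎⇒≡𝟎 (a∧b≤b ⟫ a∧b≤b ⟫ ≤-reflexive regular-part≡𝟎)))

    part′ : Bool → Carrier
    part′ true  = top
    part′ false = part false

    part′≤top : ∀ i → part′ i ≤ top
    part′≤top true  = ≤-refl
    part′≤top false = part≤whole false ⟫ proj₂ b≪top

    boundary≤below-true : boundary ≤ strictly-below true
    boundary≤below-true = boundary≤ λ where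
      ξ o (true  , p) → ⋁-upper (oldUnder? true) ξ (o , p)
      ξ o (false , p) → ⋁-upper (oldUnder? true) ξ (o , ⊑-trans p f⊑t)

  -- S2 is applied to `top` itself, and each point takes one of its two parts.
  splitting-of-incomparable : S2 L → Directed → ¬ (pt false ⊑ pt true) → Splitting
  splitting-of-incomparable s2 directed false⋢true = record
    { part          = part
    ; part≢𝟎        = part≢𝟎
    ; part≤top      = part≤whole
    ; top≤parts     = whole≤parts
    ; below≤part    = lower≤part
    ; part∧boundary = part-∧-lower
    ; part⊲boundary = part-⊲-lower
    ; part-mono     = λ where
        true  true  _ → ≤-refl
        true  false p → contradiction p true⋢false
        false true  p → contradiction p false⋢true
        false false _ → ≤-refl
    ; part-⊲        = λ where
        true  true  ¬p → contradiction ⊑-refl ¬p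
        true  false _  → part-⊲-part true
        false true  _  → part-⊲-part false
        false false ¬p → contradiction ⊑-refl ¬p
    ; part-∧        = inj₂ parts-∧
    }
    where
    -- If top contains no maximal point it has regular part 𝟎; otherwise the two points are
    -- maximal, hence without common lower bound, and the two lower parts are disjoint.
    disjoint : strictly-below true ∧ strictly-below false ∧ (𝟏 - (𝟏 - top)) ≡ 𝟎
    disjoint with any? (λ ζ → (pt true ⊑? ζ) ×-dec ¬? (ζ ⊑? pt true))
    ... | yes (ζ , p , ¬q) = ≤𝟎⇒≡𝟎 (a∧b≤b ⟫ a∧b≤b ⟫ ≤-reflexive
        (⊲⇒regular-part≡𝟎 (mono (inj₁ p)) (independent ζ⋢top)))
      where
      ζ⋢top : ¬ (ζ M.⊑ pt true)
      ζ⋢top s with ⊑⇒under s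
      ... | true  , q = ¬q q
      ... | false , q = true⋢false (⊑-trans p q)
    ... | no none = ≤𝟎⇒≡𝟎 (∧-mono ≤-refl a∧b≤a ⟫ ⋁-∧-⋁-least (oldUnder? true) (oldUnder? false)
        (λ ξ η (o , p) (o′ , q) → meet ξ η ⟫ ⋁-least (M.below₂? ξ η) (λ ζ (s , t) →
          ⊥-elim (no-common-lower-bound (⊑-trans (⊑-old o s) p) (⊑-trans (⊑-old o′ t) q)))))
      where
      no-common-lower-bound : ∀ {ζ} → ζ ⊑ pt true → ¬ (ζ ⊑ pt false)
      no-common-lower-bound p q with directed p q
      ... | ω , s , t = none (ω , s , λ u → false⋢true (⊑-trans t u))

    open Split (split s2 {top} {strictly-below} boundary≪top (nonzero (pt true)) disjoint)

  splitting : D2 L → S2 L → Directed → Splitting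
  splitting d2 s2 directed with pt false ⊑? pt true
  ... | yes p = splitting-of-comparable d2 s2 p
  ... | no ¬p = splitting-of-incomparable s2 directed ¬p

-- Q₀ is a quotient of Q by a p-morphism.
record Covers {n r r₀} (Q : Quasiorder n r) (Q₀ : Quasiorder n r₀) : Set (r ⊔ r₀) where
  open Quasiorder Q
  module C = Quasiorder Q₀
  field
    coarsen : ∀ {ξ η} → ξ ⊑ η → ξ C.⊑ η
    lift    : ∀ {ξ η} → ξ C.⊑ η → ∃ λ η′ → (ξ ⊑ η′) × (η C.≈ η′)

-- Finding a pair to merge on the way from `Q` to `Q₀`.

module _ {n r r₀} (Q : Quasiorder n r) (Q₀ : Quasiorder n r₀) (cover : Covers Q Q₀) where
  open Quasiorder Q
  open Covers cover

  Identified : Pred (Fin n) (r ⊔ r₀)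
  Identified ξ = ∃ λ η → (ξ C.≈ η) × ¬ (ξ ≈ η)

  identified? : Decidable Identified
  identified? ξ = any? (λ η → (ξ C.≈? η) ×-dec ¬? (ξ ≈? η))

  collapse-or-merge : (∀ {ξ η} → ξ C.⊑ η → ξ ⊑ η) ⊎
                      (∃ λ pt → Mergeable Q pt × (∀ i j → pt i C.⊑ pt j))
  collapse-or-merge with any? identified?
  ... | no none = inj₁ λ {ξ} {η} p → let η′ , q , e = lift p in
    ⊑-trans q (proj₂ (decidable-stable (η ≈? η′) (λ ¬e → none (η , η′ , e , ¬e))))
  ... | yes (ξ₀ , s₀) with maximal-above identified? ξ₀ s₀
  ... | ξ₁ , _ , (η₀ , t₀) , max₁
    with maximal-above (λ η → (ξ₁ C.≈? η) ×-dec ¬? (ξ₁ ≈? η)) η₀ t₀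
  ... | ξ₂ , _ , (e , ¬e) , max₂ = inj₂ (pt , mergeable , identify)
    where
    pt : Bool → Fin n
    pt true  = ξ₁
    pt false = ξ₂

    identify : ∀ i j → pt i C.⊑ pt j
    identify true  true  = C.⊑-refl
    identify true  false = proj₁ e
    identify false true  = proj₂ e
    identify false false = C.⊑-refl

    -- `ξ₂` is `Identified` as well, so maximality of `ξ₁` would make the two equivalent.
    ξ₁⋢ξ₂ : ¬ (ξ₁ ⊑ ξ₂)
    ξ₁⋢ξ₂ p = ¬e (p , max₁ ξ₂ (ξ₁ , C.≈-sym e , ¬e ∘ ≈-sym) p)

    successor : ∀ i {ζ} → pt i ⊑ ζ → (ζ ⊑ pt i) ⊎ (pt (not i) ⊑ ζ)
    successor true {ζ} p with ζ ⊑? ξ₁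
    ... | yes q = inj₁ q
    -- Nothing strictly above `ξ₁` is `Identified`, so the point over `ξ₂` obtained by lifting is
    -- equivalent to `ζ`.
    ... | no ¬q with lift (C.⊑-trans (proj₂ e) (coarsen p))
    ... | η , s , f = inj₂ (⊑-trans s (proj₂ (decidable-stable (ζ ≈? η)
      (λ ¬f → ¬q (max₁ ζ (η , f , ¬f) p)))))
    successor false {ζ} p with ξ₁ ⊑? ζ
    ... | yes q = inj₂ q
    -- The lifted `η` above `ξ₁` is not equivalent to `ζ`, hence `Identified`, hence in the class of
    -- `ξ₁` by maximality. So `Q₀` identifies `ζ` with `ξ₁`, and the choice of `ξ₂` gives `ζ ⊑ ξ₂`.
    ... | no ¬q with lift (C.⊑-trans (proj₁ e) (coarsen p))
    ... | η , s , f = inj₁ (max₂ ζ (ξ₁≈₀ζ , ¬q ∘ proj₁) p)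
      where
      η⊑ξ₁ : η ⊑ ξ₁
      η⊑ξ₁ = max₁ η (ζ , C.≈-sym f , λ g → ¬q (⊑-trans s (proj₁ g))) s

      ξ₁≈₀ζ : ξ₁ C.≈ ζ
      ξ₁≈₀ζ = C.≈-trans (coarsen s , coarsen η⊑ξ₁) (C.≈-sym f)

    mergeable : Mergeable Q pt
    mergeable = record { true⋢false = ξ₁⋢ξ₂ ; successor = successor }

  module _ {pt : Bool → Fin n} (mergeable : Mergeable Q pt) (identify : ∀ i j → pt i C.⊑ pt j) where
    open Merge Q mergeable

    merged-covers : Covers merged Q₀
    merged-covers = record
      { coarsen = λ { (inj₁ p) → coarsen p
                    ; (inj₂ ((i , p) , (j , q))) →
                        C.⊑-trans (coarsen p) (C.⊑-trans (identify i j) (coarsen q)) }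
      ; lift    = λ p → let η′ , q , e = lift p in η′ , inj₁ q , e
      }

    -- Both relations lift along the p-morphism to relations of `Q` out of the same point, where a
    -- common upper bound exists.
    merged-directed : Directed → M.Directed
    merged-directed directed p q =
      let ξ′ , p′ , s , _ = ⊑-lift p
          η′ , q′ , t , _ = ⊑-lift q
          ω , u , v = directed p′ q′
      in ω , M.⊑-trans s (inj₁ u) , M.⊑-trans t (inj₁ v)

-- The induction on merges.

module _ {ℓ n r₀} (L : CoHeyting ℓ) (d2 : D2 L) (s2 : S2 L)
         (Q₀ : Quasiorder n r₀) {x₀ : Fin n → ∣ L ∣} (ρ₀ : Realisation L Q₀ x₀) where
  open Order L
  open Joins L
  private module C = Quasiorder Q₀

  -- On the algebra of `Q₀`-down-sets `x` and `x₀` induce the same map; for the order induced by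
  -- `L₀` this says that `L₀` stays fixed.
  Extends : (u : Level) → (Fin n → Carrier) → Set (ℓ ⊔ r₀ ⊔ Level.suc u)
  Extends u x = ∀ {U : Pred (Fin n) u} (U? : Decidable U) →
                (∀ {ξ η} → ξ C.⊑ η → U η → U ξ) → ⋁ U? x ≡ ⋁ U? x₀

  -- Recursion on a list containing all unrelated pairs: a merge relates `pt true` to `pt false`, so
  -- filtering shortens the list.
  realise-by-merging : ∀ {r u} (unrelated : List (Fin n × Fin n)) → Acc _<ⁿ_ (length unrelated) →
    (Q : Quasiorder n r) → let open Quasiorder Q in
    Covers Q Q₀ → Directed → (∀ ξ η → ¬ (ξ ⊑ η) → (ξ , η) ∈ unrelated) →
    ∃ λ x → Realisation L Q x × Extends u x
  realise-by-merging unrelated (acc rec) Q cover directed listed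
    with collapse-or-merge Q Q₀ cover
  ... | inj₁ refine = x₀ , ρ , λ _ _ → refl
    where
    open Quasiorder Q
    open Realisation ρ₀

    ρ : Realisation L Q x₀
    ρ = record
      { nonzero     = nonzero
      ; mono        = λ p → mono (Covers.coarsen cover p)
      ; meet        = λ ξ η → meet ξ η ⟫
          ⋁-mono (C.below₂? ξ η) (below₂? ξ η) (λ ζ (p , q) → refine p , refine q)
      ; independent = λ ¬p → independent (¬p ∘ refine)
      }
  ... | inj₂ (pt , mergeable , identify)
    with realise-by-merging (filter still-unrelated? unrelated) (rec shorter) merged
           (merged-covers Q Q₀ cover mergeable identify)
           (merged-directed Q Q₀ cover mergeable identify directed)
           (λ ξ η ¬p → ∈-filter⁺ still-unrelated? (listed ξ η (¬p ∘ inj₁)) ¬p)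
    where
    open Merge Q mergeable

    still-unrelated? : Decidable (λ (ξ , η) → ¬ (ξ M.⊑ η))
    still-unrelated? (ξ , η) = ¬? (ξ M.⊑? η)

    shorter : length (filter still-unrelated? unrelated) <ⁿ length unrelated
    shorter = filter-notAll still-unrelated? unrelated
      (lose (listed (pt true) (pt false) (Mergeable.true⋢false mergeable))
            (λ ¬p → ¬p (under⇒⊑ (true , Quasiorder.⊑-refl Q) false)))
  -- A `Q₀`-down-set is also a down-set of the merged order, so undoing the merge preserves its
  -- join.
  ... | x′ , ρ′ , extends′ = x , refined , λ U? down →
      trans (⋁-refine U? (λ p → down (Covers.coarsen merged-cover p))) (extends′ U? down)
    where
    open Unmerge L Q mergeable ρ′
    open Refine (splitting d2 s2 directed)

    merged-cover : Covers (Merge.merged Q mergeable) Q₀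
    merged-cover = merged-covers Q Q₀ cover mergeable identify

-- Finite algebras and their join-prime elements.

module FiniteAlgebra {ℓ} (A : CoHeyting ℓ) (finite : Finite A) where
  open Order A
  open Joins A
  open Inverse (proj₂ finite) using (to; from; strictlyInverseʳ)

  size : ℕ
  size = proj₁ finite

  -- Opaque here and below, since normalisation would unfold the enumeration of all elements.
  abstract
    _≤?_ : ∀ a b → Dec (a ≤ b)
    a ≤? b = via-injection (↔⇒↣ (proj₂ finite)) _≟ᶠ_ (a ∧ b) a

  all-elements? : ∀ {p} {P : Pred Carrier p} → Decidable P → Dec (∀ a → P a)
  all-elements? {P = P} P? = map′ (λ f a → subst P (strictlyInverseʳ a) (f (to a))) (λ f ξ → f (from ξ))
                                  (all? (λ ξ → P? (from ξ)))

  -- Reversed, so that `maximal-above` yields minimal elements.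
  dual-order : Quasiorder size ℓ
  dual-order = record
    { _⊑_ = λ ξ η → from η ≤ from ξ ; _⊑?_ = λ ξ η → from η ≤? from ξ
    ; ⊑-refl = ≤-refl ; ⊑-trans = λ p q → q ⟫ p }

  minimal : ∀ {p} {P : Pred Carrier p} → Decidable P → ∃ P →
            ∃ λ a → P a × (∀ b → P b → b ≤ a → a ≤ b)
  minimal {P = P} P? (a , Pa)
    with Quasiorder.maximal-above dual-order (λ ξ → P? (from ξ)) (to a) (subst P (sym (strictlyInverseʳ a)) Pa)
  ... | ξ , _ , Pξ , min = from ξ , Pξ , λ b Pb → subst (λ b → P b → b ≤ from ξ → from ξ ≤ b)
    (strictlyInverseʳ b) (min (to b)) Pb

  Prime : Pred Carrier ℓ
  Prime j = ¬ (j ≡ 𝟎) × (∀ a b → j ≤ a ∨ b → (j ≤ a) ⊎ (j ≤ b))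

  prime? : Decidable Prime
  prime? j = map′ (_∘ ≤-reflexive) (_∘ ≤𝟎⇒≡𝟎) (¬? (j ≤? 𝟎)) ×-dec
    all-elements? (λ a → all-elements? (λ b → (j ≤? (a ∨ b)) →-dec ((j ≤? a) ⊎-dec (j ≤? b))))

  abstract
    primes : List Carrier
    primes = filter prime? (map from (allFin size))

    rank : ℕ
    rank = length primes

    point : Fin rank → Carrier
    point = lookup primes

    point-prime : ∀ ξ → Prime (point ξ)
    point-prime ξ = All.lookup (all-filter prime? (map from (allFin size))) (∈-lookup ξ)

    prime-is-point : ∀ {j} → Prime j → ∃ λ ξ → j ≡ point ξ
    prime-is-point {j} prime = index j∈primes , lookup-index j∈primes
      where
      j∈primes : j ∈ primes
      j∈primes = ∈-filter⁺ prime?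
        (subst (_∈ map from (allFin size)) (strictlyInverseʳ j) (∈-map⁺ from (∈-allFin (to j)))) prime

  -- A minimal `j` below `a` and not below `b` is prime: if `j ≤ c ∨ d` with `j` below neither,
  -- minimality puts `j ∧ c` and `j ∧ d` below `b`, hence also `j`.
  separate : ∀ {a b} → ¬ (a ≤ b) → ∃ λ ξ → (point ξ ≤ a) × ¬ (point ξ ≤ b)
  separate {a} {b} a≰b with minimal (λ j → (j ≤? a) ×-dec ¬? (j ≤? b)) (a , ≤-refl , a≰b)
  ... | j , (j≤a , j≰b) , min with prime-is-point (j≢𝟎 , prime)
    where
    j≢𝟎 : ¬ (j ≡ 𝟎)
    j≢𝟎 e = j≰b (≤-reflexive e ⟫ 𝟎≤)

    below-b : ∀ {c} → ¬ (j ≤ c) → j ∧ c ≤ b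
    below-b {c} j≰c = decidable-stable ((j ∧ c) ≤? b)
      (λ s → j≰c (min (j ∧ c) (a∧b≤a ⟫ j≤a , s) a∧b≤a ⟫ a∧b≤b))

    prime : ∀ c d → j ≤ c ∨ d → (j ≤ c) ⊎ (j ≤ d)
    prime c d p with j ≤? c | j ≤? d
    ... | yes q | _     = inj₁ q
    ... | no _  | yes q = inj₂ q
    ... | no s  | no t  = contradiction (∧-glb ≤-refl p ⟫ ∧∨-lub (below-b s) (below-b t)) j≰b
  ... | ξ , refl = ξ , j≤a , j≰b

  ≤-by-points : ∀ {a b} → (∀ ξ → point ξ ≤ a → point ξ ≤ b) → a ≤ b
  ≤-by-points {a} {b} f = decidable-stable (a ≤? b)
    (λ s → let ξ , p , ¬p = separate s in ¬p (f ξ p))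

  point-⋁ : ∀ {n p} {U : Pred (Fin n) p} (U? : Decidable U) {x : Fin n → Carrier} ξ →
            point ξ ≤ ⋁ U? x → ∃ λ η → U η × (point ξ ≤ x η)
  point-⋁ {U = U} U? {x} ξ = ⋁-ind U? (λ a → point ξ ≤ a → ∃ λ η → U η × (point ξ ≤ x η))
    (λ p → contradiction (≤𝟎⇒≡𝟎 p) (proj₁ (point-prime ξ)))
    (λ f g p → [ f , g ]′ (proj₂ (point-prime ξ) _ _ p))
    (λ η u p → η , u , p)

  point-order : Quasiorder rank ℓ
  point-order = record
    { _⊑_ = λ ξ η → point ξ ≤ point η ; _⊑?_ = λ ξ η → point ξ ≤? point η
    ; ⊑-refl = ≤-refl ; ⊑-trans = _⟫_ }

  open Quasiorder point-order

  point≤diff : ∀ {a b ξ} → point ξ ≤ a → ¬ (point ξ ≤ b) → point ξ ≤ a - b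
  point≤diff {a} {b} {ξ} p ¬q with proj₂ (point-prime ξ) b (a - b) (p ⟫ diff-ub a b)
  ... | inj₁ q = contradiction q ¬q
  ... | inj₂ q = q

  -- `b` and the join of the points of `a` outside `b` cover `a`, so `a - b` is below that join, and
  -- primality selects one of its points.
  point-of-diff : ∀ {a b ξ} → point ξ ≤ a - b → ∃ λ η → (ξ ⊑ η) × (point η ≤ a) × ¬ (point η ≤ b)
  point-of-diff {a} {b} {ξ} p =
    let η , (q , ¬r) , s = point-⋁ outside? ξ (p ⟫ diff-least a b _ (≤-by-points bound)) in η , s , q , ¬r
    where
    outside? : Decidable (λ η → (point η ≤ a) × ¬ (point η ≤ b))
    outside? η = (point η ≤? a) ×-dec ¬? (point η ≤? b)

    bound : ∀ η → point η ≤ a → point η ≤ b ∨ ⋁ outside? point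
    bound η q with point η ≤? b
    ... | yes r = r ⟫ a≤a∨b
    ... | no ¬r = ⋁-upper outside? η (q , ¬r) ⟫ b≤a∨b

  -- Take maximal points `α` above `ξ` and `β` above `η`. If `β` is not below `α`, then `β` is below
  -- `𝟏 - α`, while `α` is below `𝟏 - (𝟏 - α)` by maximality; `ζ` would lie below both, against the
  -- V₂ identity.
  directed : InV₂ A → Directed
  directed v₂ {ζ} {ξ} {η} p q
    with maximal-above (λ ω → point ξ ≤? point ω) ξ ≤-refl
       | maximal-above (λ ω → point η ≤? point ω) η ≤-refl
  ... | α , _ , ξ≤α , max-α | β , _ , η≤β , max-β with point β ≤? point α
  ... | yes β≤α = α , ξ≤α , η≤β ⟫ β≤α
  ... | no β≰α = contradiction (≤𝟎⇒≡𝟎 (∧-glb (q ⟫ η≤β ⟫ β≤) (p ⟫ ξ≤α ⟫ α≤) ⟫ ≤-reflexive (v₂ (point α))))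
                               (proj₁ (point-prime ζ))
    where
    β≤ : point β ≤ 𝟏 - point α
    β≤ = point≤diff ≤𝟏 β≰α

    α≤ : point α ≤ 𝟏 - (𝟏 - point α)
    α≤ = point≤diff ≤𝟏 λ s → let ω , α≤ω , _ , ω≰α = point-of-diff s in
      ω≰α (max-α ω (ξ≤α ⟫ α≤ω) α≤ω)

module EmbeddingOrder {ℓ ℓ′} {A : CoHeyting ℓ} {B : CoHeyting ℓ′} {f : ∣ A ∣ → ∣ B ∣}
                      (f-embedding : IsEmbedding A B f) where
  open IsEmbedding f-embedding
  private
    module A = Order A
    module B = Order B
    module JA = Joins A
    module JB = Joins B

  monotone : ∀ {a b} → a A.≤ b → f a B.≤ f b
  monotone p = trans (sym (pres-∧ _ _)) (cong f p)

  reflecting : ∀ {a b} → f a B.≤ f b → a A.≤ b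
  reflecting p = injective _ _ (trans (pres-∧ _ _) p)

  ⋁≤ : ∀ {n p} {U : Pred (Fin n) p} (U? : Decidable U) {x : Fin n → ∣ A ∣} →
       f (JA.⋁ U? x) B.≤ JB.⋁ U? (f ∘ x)
  ⋁≤ U? {x} = JA.⋁-ind U? (λ a → f a B.≤ JB.⋁ U? (f ∘ x)) (B.≤-reflexive pres-𝟎 B.⟫ B.𝟎≤)
    (λ p q → B.≤-reflexive (pres-∨ _ _) B.⟫ B.∨-lub p q) (λ ξ → JB.⋁-upper U? ξ)

-- From a realisation of the points to an embedding.

module Representation {ℓ ℓ₁} (L : CoHeyting ℓ) (L₁ : CoHeyting ℓ₁) (finite₁ : Finite L₁)
                      {x : Fin (FiniteAlgebra.rank L₁ finite₁) → ∣ L ∣}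
                      (ρ : Realisation L (FiniteAlgebra.point-order L₁ finite₁) x) where
  open FiniteAlgebra L₁ finite₁
  open Realisation ρ
  open Order L
  open Joins L
  private module L₁ = Order L₁

  below? : ∀ a → Decidable (λ ξ → point ξ L₁.≤ a)
  below? a ξ = point ξ ≤? a

  represent : ∣ L₁ ∣ → Carrier
  represent a = ⋁ (below? a) x

  represent-mono : ∀ {a b} → a L₁.≤ b → represent a ≤ represent b
  represent-mono {a} {b} p = ⋁-mono (below? a) (below? b) (λ ξ q → q L₁.⟫ p)

  point-⊲-represent : ∀ {ξ a} → ¬ (point ξ L₁.≤ a) → x ξ ⊲ represent a
  point-⊲-represent {ξ} {a} ¬p = ⋁-⊲ (below? a) (λ η q → independent (λ r → ¬p (r L₁.⟫ q)))

  represent-reflects-≤ : ∀ {a b} → represent a ≤ represent b → a L₁.≤ b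
  represent-reflects-≤ {a} {b} p = ≤-by-points λ ξ q → decidable-stable (point ξ ≤? b) λ ¬r →
    nonzero ξ (⊲-above⇒≡𝟎 (point-⊲-represent ¬r) (⋁-upper (below? a) ξ q ⟫ p))

  represent-∨ : ∀ a b → represent (a L₁.∨ b) ≡ represent a ∨ represent b
  represent-∨ a b = ≤-antisym
    (⋁-least (below? (a L₁.∨ b)) λ ξ p →
      [ (λ q → ⋁-upper (below? a) ξ q ⟫ a≤a∨b) , (λ q → ⋁-upper (below? b) ξ q ⟫ b≤a∨b) ]′
        (proj₂ (point-prime ξ) a b p))
    (∨-lub (represent-mono L₁.a≤a∨b) (represent-mono L₁.b≤a∨b))

  represent-∧ : ∀ a b → represent (a L₁.∧ b) ≡ represent a ∧ represent b
  represent-∧ a b = ≤-antisym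
    (∧-glb (represent-mono L₁.a∧b≤a) (represent-mono L₁.a∧b≤b))
    (⋁-∧-⋁-least (below? a) (below? b) λ ξ η p q → meet ξ η ⟫
      ⋁-mono (Quasiorder.below₂? point-order ξ η) (below? (a L₁.∧ b))
        (λ ζ (r , s) → L₁.∧-glb (r L₁.⟫ p) (s L₁.⟫ q)))

  represent-diff : ∀ a b → represent (a L₁.- b) ≡ represent a - represent b
  represent-diff a b = ≤-antisym
    (⋁-least (below? (a L₁.- b)) λ ξ p →
      -- `x η` is below `represent b ∨ (represent a - represent b)`, and `⊲` removes `represent b`.
      let η , ξ≤η , η≤a , η≰b = point-of-diff p in
      mono ξ≤η ⟫ point-⊲-represent η≰b (⋁-upper (below? a) η η≤a ⟫ diff-ub _ _))
    (diff-least _ _ _ (represent-mono (L₁.diff-ub a b) ⟫ ≤-reflexive (represent-∨ b (a L₁.- b))))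

  -- Preservation of `𝟏` is a premise because `Realisation` does not ask for a family with join `𝟏`.
  represent-embedding : represent L₁.𝟏 ≡ 𝟏 → IsEmbedding L₁ L represent
  represent-embedding pres-𝟏 = record
    { injective = λ a b e → L₁.≤-antisym (represent-reflects-≤ (≤-reflexive e))
                                         (represent-reflects-≤ (≤-reflexive (sym e)))
    ; pres-𝟎 = ≤𝟎⇒≡𝟎 (⋁-least (below? L₁.𝟎) λ ξ p →
        contradiction (L₁.≤𝟎⇒≡𝟎 p) (proj₁ (point-prime ξ)))
    ; pres-𝟏 = pres-𝟏
    ; pres-∨ = represent-∨
    ; pres-∧ = represent-∧
    ; pres-- = represent-diff
    }

-- The quasiorder that `L₀` induces on the points of `L₁`.

module Restriction {ℓ₀ ℓ₁} (L₀ : CoHeyting ℓ₀) (finite₀ : Finite L₀)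
                   (L₁ : CoHeyting ℓ₁) (finite₁ : Finite L₁) (i : Embedding L₀ L₁) where
  open Order L₀
  open Joins L₀
  open FiniteAlgebra L₁ finite₁
  open EmbeddingOrder (proj₂ i)
  open IsEmbedding (proj₂ i)
  private
    module L₁ = Order L₁
    module F₀ = FiniteAlgebra L₀ finite₀

  ι : ∣ L₀ ∣ → ∣ L₁ ∣
  ι = proj₁ i

  abstract
    hull-exists : ∀ ξ → ∃ λ a → (point ξ L₁.≤ ι a) × (∀ b → point ξ L₁.≤ ι b → b ≤ a → a ≤ b)
    hull-exists ξ = F₀.minimal (λ a → point ξ ≤? ι a) (𝟏 , subst (point ξ L₁.≤_) (sym pres-𝟏) L₁.≤𝟏)

  hull : Fin rank → Carrier
  hull ξ = proj₁ (hull-exists ξ)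

  point≤hull : ∀ ξ → point ξ L₁.≤ ι (hull ξ)
  point≤hull ξ = proj₁ (proj₂ (hull-exists ξ))

  -- The elements of `L₀` with image above `point ξ` are closed under meets, so a minimal one is
  -- least.
  hull≤ : ∀ {ξ a} → point ξ L₁.≤ ι a → hull ξ ≤ a
  hull≤ {ξ} {a} p = proj₂ (proj₂ (hull-exists ξ)) (hull ξ ∧ a)
    (subst (point ξ L₁.≤_) (sym (pres-∧ (hull ξ) a)) (L₁.∧-glb (point≤hull ξ) p)) a∧b≤a ⟫ a∧b≤b

  point≤ : ∀ {ξ a} → hull ξ ≤ a → point ξ L₁.≤ ι a
  point≤ {ξ} p = point≤hull ξ L₁.⟫ monotone p

  hull-order : Quasiorder rank ℓ₀
  hull-order = record
    { _⊑_ = λ ξ η → hull ξ ≤ hull η ; _⊑?_ = λ ξ η → hull ξ F₀.≤? hull η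
    ; ⊑-refl = ≤-refl ; ⊑-trans = _⟫_ }

  below? : ∀ a → Decidable (λ ξ → point ξ L₁.≤ ι a)
  below? a ξ = point ξ ≤? ι a

  ≤⋁hull : ∀ a → a ≤ ⋁ (below? a) hull
  ≤⋁hull a = reflecting (≤-by-points λ ξ p → point≤ (⋁-upper (below? a) ξ p))

  -- `point ξ` is below `ι (hull ξ)` but not below `ι (hull η)`, hence below the image of the
  -- difference, so `hull ξ ≤ hull ξ - hull η`.
  hull-⊲ : ∀ {ξ η} → ¬ (hull ξ ≤ hull η) → hull ξ ⊲ hull η
  hull-⊲ {ξ} {η} ¬p q = hull≤ (point≤diff (point≤hull ξ) (¬p ∘ hull≤)
    L₁.⟫ L₁.≤-reflexive (sym (pres-- _ _))) ⟫ diff-least _ _ _ q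

  hull-realisation : Realisation L₀ hull-order hull
  hull-realisation = record
    { nonzero     = λ ξ e → proj₁ (point-prime ξ)
        (L₁.≤𝟎⇒≡𝟎 (subst (point ξ L₁.≤_) (trans (cong ι e) pres-𝟎) (point≤hull ξ)))
    ; mono        = λ p → p
    ; meet        = λ ξ η → ≤⋁hull (hull ξ ∧ hull η) ⟫
        ⋁-mono (below? (hull ξ ∧ hull η)) (below₂? ξ η)
          (λ ζ p → hull≤ p ⟫ a∧b≤a , hull≤ p ⟫ a∧b≤b)
    ; independent = λ ¬p → hull-⊲ ¬p
    }
    where open Quasiorder hull-order using (below₂?)

  -- For hull ξ ≤ hull η, a point above ξ with the same hull as η is found below the difference of
  -- hull η and the largest element of L₀ that is not above η.
  point-order-covers : Covers point-order hull-order
  point-order-covers = record { coarsen = λ {ξ} {η} p → hull≤ (p L₁.⟫ point≤hull η) ; lift = lift }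
    where
    avoids? : ∀ η → Decidable (λ ζ → ¬ (hull η ≤ hull ζ))
    avoids? η ζ = ¬? (hull η F₀.≤? hull ζ)

    largest-avoiding : Fin rank → Carrier
    largest-avoiding η = ⋁ (avoids? η) hull

    -- By primality `point η` would be below a single `ι (hull ζ)` of the join, forcing
    -- `hull η ≤ hull ζ`.
    avoiding : ∀ η → ¬ (point η L₁.≤ ι (largest-avoiding η))
    avoiding η p = let ζ , ¬q , q = point-⋁ (avoids? η) η (p L₁.⟫ ⋁≤ (avoids? η)) in ¬q (hull≤ q)

    hull≤hull-avoiding : ∀ η → hull η ≤ hull η - largest-avoiding η
    hull≤hull-avoiding η =
      hull≤ (subst (point η L₁.≤_) (sym (pres-- _ _)) (point≤diff (point≤hull η) (avoiding η)))

    lift : ∀ {ξ η} → hull ξ ≤ hull η →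
           ∃ λ η′ → (point ξ L₁.≤ point η′) × (hull η ≤ hull η′) × (hull η′ ≤ hull η)
    lift {ξ} {η} p = same-hull (point-of-diff
      (subst (point ξ L₁.≤_) (pres-- _ _) (point≤ (p ⟫ hull≤hull-avoiding η))))
      where
      same-hull : (∃ λ η′ → (point ξ L₁.≤ point η′) × (point η′ L₁.≤ ι (hull η)) ×
                             ¬ (point η′ L₁.≤ ι (largest-avoiding η))) →
                  ∃ λ η′ → (point ξ L₁.≤ point η′) × (hull η ≤ hull η′) × (hull η′ ≤ hull η)
      same-hull (η′ , ξ≤η′ , q , ¬r) = η′ , ξ≤η′
        , decidable-stable (hull η F₀.≤? hull η′) (λ ¬s → ¬r (point≤ (⋁-upper (avoids? η) η′ ¬s)))
        , hull≤ q

transport : ∀ {ℓ ℓ′ n r} {A : CoHeyting ℓ} {B : CoHeyting ℓ′} {Q : Quasiorder n r}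
            {x : Fin n → ∣ A ∣} {f : ∣ A ∣ → ∣ B ∣} → IsEmbedding A B f →
            Realisation A Q x → Realisation B Q (f ∘ x)
transport {A = A} {B} {Q} {f = f} emb ρ = record
  { nonzero     = λ ξ e → nonzero ξ (injective _ _ (trans e (sym pres-𝟎)))
  ; mono        = λ p → monotone (mono p)
  ; meet        = λ ξ η → B.≤-reflexive (sym (pres-∧ _ _)) B.⟫ monotone (meet ξ η)
      B.⟫ ⋁≤ (Quasiorder.below₂? Q ξ η)
  ; independent = λ ¬p → B.≡⇒⊲ (trans (sym (pres-- _ _)) (cong f (A.⊲⇒≡ (independent ¬p))))
  }
  where
  open IsEmbedding emb
  open EmbeddingOrder emb
  open Realisation ρ
  module A = Order A
  module B = Order B

theorem5p5 : ∀ {ℓ ℓ₀ ℓ₁} (L : CoHeyting ℓ) → InV₂ L → D2 L → S2 L →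
    (L₀ : CoHeyting ℓ₀) → Finite L₀ → (e₀ : Embedding L₀ L) →
    (L₁ : CoHeyting ℓ₁) → InV₂ L₁ → Finite L₁ → (i : Embedding L₀ L₁) →
    Σ (Embedding L₁ L) λ g → ∀ x → proj₁ g (proj₁ i x) ≡ proj₁ e₀ x
theorem5p5 {ℓ₁ = ℓ₁} L _ d2 s2 L₀ finite₀ (e , e-embedding) L₁ v₂ finite₁ i =
  (represent , represent-embedding represent-𝟏) , fixes
  where
  open Order L
  open Joins L
  open FiniteAlgebra L₁ finite₁
  open Restriction L₀ finite₀ L₁ finite₁ i
  open EmbeddingOrder e-embedding
  module L₁ = CoHeyting L₁

  pairs : List (Fin rank × Fin rank)
  pairs = cartesianProduct (allFin rank) (allFin rank)

  realised : ∃ λ x → Realisation L point-order x ×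
                     Extends L d2 s2 hull-order (transport e-embedding hull-realisation) ℓ₁ x
  realised = realise-by-merging L d2 s2 hull-order (transport e-embedding hull-realisation)
    pairs (<-wellFounded (length pairs)) point-order point-order-covers (directed v₂)
    (λ ξ η _ → ∈-cartesianProduct⁺ (∈-allFin ξ) (∈-allFin η))

  open Representation L L₁ finite₁ (proj₁ (proj₂ realised)) hiding (below?)

  -- The points below `ι a` form a down-set of `hull-order`, so their join is that of the elements
  -- `e (hull ξ)`, and these hulls join to `a` in `L₀`.
  fixes : ∀ a → represent (ι a) ≡ e a
  fixes a = trans (proj₂ (proj₂ realised) (below? a) (λ p q → point≤ (Order._⟫_ L₀ p (hull≤ q))))
    (≤-antisym (⋁-least (below? a) (λ ξ p → monotone (hull≤ p)))
               (monotone (≤⋁hull a) ⟫ ⋁≤ (below? a)))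

  -- `𝟏` comes from `L₀`, so `fixes` determines its value.
  represent-𝟏 : represent L₁.𝟏 ≡ 𝟏
  represent-𝟏 = trans (cong represent (sym (IsEmbedding.pres-𝟏 (proj₂ i))))
    (trans (fixes _) (IsEmbedding.pres-𝟏 e-embedding))
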